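{- The $\mathrm{FO}(<)$-expressible fragment of $\mathrm{Mon}\Sigma^1_1$ is not $\mathrm{Tower}(o(\sqrt{m}))$-succinct in $\mathrm{FO}(<)$ on the class of linear orders. That is, there is no function $g\colon\mathbb{N}\to\mathbb{N}$ with $g(m)=o(\sqrt{m})$ such that for every $\mathrm{Mon}\Sigma^1_1$-sentence $\Phi$ of signature $\{<\}$ that is equivalent on all linear orders $\mathcal{A}_N$ to some $\mathrm{FO}(<)$-sentence, there exists an $\mathrm{FO}(<)$-sentence $\psi$ with $|\psi|\le \mathrm{Tower}(g(|\Phi|))$ and $\mathcal{A}_N\models\psi\iff\mathcal{A}_N\models\Phi$ for all $N\in\mathbb{N}$.
   Context: For $N\in\mathbb{N}$, $\mathcal{A}_N$ is the linear order with universe $\{0,\dots,N\}$ and natural order $<$; the class of linear orders is $\{\mathcal{A}_N:N\in\mathbb{N}\}$. $\mathrm{Mon}\Sigma^1_1$ is the class of monadic second-order formulas consisting of a prefix of existential quantifiers over unary relations (sets), followed by a first-order formula. $\mathrm{FO}(<)$ is first-order logic over signature $\{<\}$. The size of a formula is the number of nodes of its syntax tree. $\mathrm{Tower}\colon\mathbb{N}\to\mathbb{N}$ is defined by $\mathrm{Tower}(0)=1$ and $\mathrm{Tower}(h+1)=2^{\mathrm{Tower}(h)}$. -}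

module Defs where

open import Data.Nat using (ℕ; zero; suc; _+_; _*_; _^_; _≤_)
open import Data.Fin using (Fin)
open import Data.Bool using (Bool; true)
open import Data.Product using (Σ; _×_)
open import Data.Sum using (_⊎_)
open import Data.Empty using (⊥)
open import Relation.Binary.PropositionalEquality using (_≡_)
open import Function.Bundles using (_⇔_)

Tower : ℕ → ℕ
Tower zero    = 1
Tower (suc h) = 2 ^ Tower h

-- First-order formulas over signature {<} extended by k unary (set)
-- variables X₀..X_{k-1}, with n free first-order variables (de Bruijn).
data Fm (k : ℕ) : ℕ → Set where
  lt  : ∀ {n} → Fin n → Fin n → Fm k n
  eq  : ∀ {n} → Fin n → Fin n → Fm k n
  mem : ∀ {n} → Fin k → Fin n → Fm k n
  neg : ∀ {n} → Fm k n → Fm k n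
  and : ∀ {n} → Fm k n → Fm k n → Fm k n
  or  : ∀ {n} → Fm k n → Fm k n → Fm k n
  ex  : ∀ {n} → Fm k (suc n) → Fm k n
  all : ∀ {n} → Fm k (suc n) → Fm k n

size : ∀ {k n} → Fm k n → ℕ
size (lt x y)  = 1
size (eq x y)  = 1
size (mem X x) = 1
size (neg φ)   = suc (size φ)
size (and φ ψ) = suc (size φ + size ψ)
size (or φ ψ)  = suc (size φ + size ψ)
size (ex φ)    = suc (size φ)
size (all φ)   = suc (size φ)

FOSentence : Set
FOSentence = Fm 0 0

-- MonΣ¹₁-sentences of signature {<}: ∃X₀ … ∃X_{k-1} φ with φ first-order
record MonΣ11 : Set where
  constructor mon
  field
    nsets : ℕ
    body  : Fm nsets 0
open MonΣ11 public

sizeΣ : MonΣ11 → ℕ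
sizeΣ Φ = nsets Φ + size (body Φ)

-- Semantics in 𝒜_N = ({0,…,N}, <); elements are Fin (suc N)
module _ (N : ℕ) where
  Elem : Set
  Elem = Fin (suc N)

  infix 4 _<E_
  _<E_ : Elem → Elem → Set
  x <E y = Data.Fin._<_ x y

  extend : ∀ {n} → (Fin n → Elem) → Elem → Fin (suc n) → Elem
  extend ρ a Fin.zero    = a
  extend ρ a (Fin.suc i) = ρ i

  Sat : ∀ {k n} → (Fin k → Elem → Bool) → (Fin n → Elem) → Fm k n → Set
  Sat S ρ (lt x y)  = ρ x <E ρ y
  Sat S ρ (eq x y)  = ρ x ≡ ρ y
  Sat S ρ (mem X x) = S X (ρ x) ≡ true
  Sat S ρ (neg φ)   = Sat S ρ φ → ⊥
  Sat S ρ (and φ ψ) = Sat S ρ φ × Sat S ρ ψ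
  Sat S ρ (or φ ψ)  = Sat S ρ φ ⊎ Sat S ρ ψ
  Sat S ρ (ex φ)    = Σ Elem λ a → Sat S (extend ρ a) φ
  Sat S ρ (all φ)   = (a : Elem) → Sat S (extend ρ a) φ

  noSets : Fin 0 → Elem → Bool
  noSets ()

  noVars : Fin 0 → Elem
  noVars ()

  ⊨FO : FOSentence → Set
  ⊨FO ψ = Sat noSets noVars ψ

  ⊨Σ : MonΣ11 → Set
  ⊨Σ Φ = Σ (Fin (nsets Φ) → Elem → Bool) λ S → Sat S noVars (body Φ)

FOExpressible : MonΣ11 → Set
FOExpressible Φ = Σ FOSentence λ χ → (N : ℕ) → (⊨Σ N Φ ⇔ ⊨FO N χ)

-- g(m) = o(√m):  for every c ≥ 1 there is M with g(m) ≤ √m / c for m ≥ M,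
-- i.e. (c · g(m))² ≤ m.
IsLittleOSqrt : (ℕ → ℕ) → Set
IsLittleOSqrt g = (c : ℕ) → Σ ℕ λ M → (m : ℕ) → M ≤ m → (suc c * g m) ^ 2 ≤ m

{-# OPTIONS --safe #-}

-- Words over the letters 0,…,h code lists of hereditarily finite sets: a letter i + 1 stands for
-- the set of those sets coded by the letters i that precede it with no letter above i in between.
-- Guessing the letters with the sets "level ≥ i" and requiring that siblings code distinct sets
-- takes a formula Φ h of size O(h²), since equality of sets of rank i has a formula of size O(i).
-- There are only Tower i sets of rank i, so by the pigeonhole principle Φ h has no long models and
-- is therefore FO(<)-expressible; but listing all sets of rank h gives a model with at least
-- Tower h elements. On the other hand, an FO(<)-sentence of size q cannot distinguish two linear
-- orders with at least 2 ^ q elements (Ehrenfeucht–Fraïssé).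
module Submission where

open import Defs
open import Data.Bool using (Bool; true)
import Data.Bool.Properties as Bool
open import Data.Fin using (Fin; zero; suc; toℕ; fromℕ<; funToFin; finToFun)
open import Data.Fin.Properties using (any?; all?; toℕ<n; toℕ-fromℕ<; toℕ-injective; pigeonhole; finToFun-funToFin) renaming (_≟_ to _≟F_)
open import Data.List using (List; []; _∷_; _++_; [_]; map; length)
open import Data.List.Membership.Propositional using (_∈_)
open import Data.List.Properties using (length-++; length-map)
open import Data.List.Relation.Unary.All using (All; []; _∷_)
import Data.List.Relation.Unary.All as All
import Data.List.Relation.Unary.All.Properties as All
open import Data.List.Relation.Unary.AllPairs using (AllPairs; []; _∷_)
import Data.List.Relation.Unary.AllPairs.Properties as AllPairs
open import Data.List.Relation.Unary.Any using (here; there)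
open import Data.Nat using (ℕ; zero; suc; pred; _+_; _*_; _∸_; _^_; _≤_; _<_; z≤n; s≤s; s≤s⁻¹; _≤?_; _<?_; _≤ᵇ_; >-nonZero)
open import Data.Nat.Properties
open import Data.Nat.Tactic.RingSolver using (solve-∀)
open import Data.Product using (Σ; ∃; _×_; _,_; proj₁; proj₂)
open import Data.Sum using (_⊎_; inj₁; inj₂; [_,_]′; reduce)
open import Data.Unit using (⊤; tt)
import Data.Vec.Functional as Vector
open import Function using (_∘_)
open import Function.Bundles using (_⇔_; mk⇔; Equivalence)
open import Relation.Binary.Definitions using (Tri; tri<; tri≈; tri>)
open import Relation.Binary.PropositionalEquality using (_≡_; refl; sym; trans; cong; cong₂; subst; subst₂)
open import Relation.Nullary using (¬_; Dec; yes; no; contradiction)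
open import Relation.Nullary.Decidable using (_×-dec_; _⊎-dec_; ¬?; ¬¬-excluded-middle)

-- First-order logic on long linear orders

-- Equality of distances up to a threshold: distances of at least `t` look alike to a player with
-- few rounds left.
Close : ℕ → ℕ → ℕ → Set
Close t d d′ = d ≡ d′ ⊎ (t ≤ d × t ≤ d′)

close-sym : ∀ {t d d′} → Close t d d′ → Close t d′ d
close-sym (inj₁ e)       = inj₁ (sym e)
close-sym (inj₂ (p , q)) = inj₂ (q , p)

close-weaken : ∀ {s t d d′} → s ≤ t → Close t d d′ → Close s d d′
close-weaken s≤t (inj₁ e)       = inj₁ e
close-weaken s≤t (inj₂ (p , q)) = inj₂ (≤-trans s≤t p , ≤-trans s≤t q)

close-+ : ∀ {t a a′ b b′} → Close t a a′ → Close t b b′ → Close t (a + b) (a′ + b′)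
close-+ (inj₁ refl) (inj₁ refl)    = inj₁ refl
close-+ {a = a} {a′} (inj₁ _) (inj₂ (p , q)) = inj₂ (≤-trans p (m≤n+m _ a) , ≤-trans q (m≤n+m _ a′))
close-+ (inj₂ (p , q)) _           = inj₂ (≤-trans p (m≤m+n _ _) , ≤-trans q (m≤m+n _ _))

-- A part shorter than `t` is copied exactly, which leaves at least `t` of `D′` for the other. If
-- both parts are long, it suffices to leave `t` on each side, as the cut at `t` does.
close-split : ∀ t d e {D′} → Close (2 * t) (d + e) D′ →
              ∃ λ d′ → ∃ λ e′ → d′ + e′ ≡ D′ × Close t d d′ × Close t e e′
close-split t d e (inj₁ refl) = d , e , refl , inj₁ refl , inj₁ refl
close-split t d e {D′} (inj₂ (p , q)) = split (t ≤? d) (t ≤? e)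
  where
  t+t≤D′ : t + t ≤ D′
  t+t≤D′ = subst (λ u → t + u ≤ D′) (+-identityʳ t) q
  t+t≤d+e : t + t ≤ d + e
  t+t≤d+e = subst (λ u → t + u ≤ d + e) (+-identityʳ t) p
  large : ∀ {u v w} → t + t ≤ v → u ≤ t → u + w ≡ v → t ≤ w
  large {u} {v} {w} t+t≤v u≤t refl = +-cancelˡ-≤ t t w (≤-trans t+t≤v (+-monoˡ-≤ w u≤t))
  left : ∀ {u} → u ≤ t → u + (D′ ∸ u) ≡ D′
  left u≤t = m+[n∸m]≡n (≤-trans u≤t (≤-trans (m≤m+n t t) t+t≤D′))
  split : Dec (t ≤ d) → Dec (t ≤ e) →
          ∃ λ d′ → ∃ λ e′ → d′ + e′ ≡ D′ × Close t d d′ × Close t e e′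
  split (no t≰d) _ =
    let d≤t = <⇒≤ (≰⇒> t≰d) in
    d , D′ ∸ d , left d≤t , inj₁ refl , inj₂ (large t+t≤d+e d≤t refl , large t+t≤D′ d≤t (left d≤t))
  split (yes t≤d) (no t≰e) =
    let e≤t = <⇒≤ (≰⇒> t≰e) in
    D′ ∸ e , e , trans (+-comm (D′ ∸ e) e) (left e≤t) ,
    inj₂ (t≤d , large t+t≤D′ e≤t (left e≤t)) , inj₁ refl
  split (yes t≤d) (yes t≤e) =
    t , D′ ∸ t , left ≤-refl , inj₂ (t≤d , ≤-refl) , inj₂ (t≤e , large t+t≤D′ ≤-refl (left ≤-refl))

-- Stated for an abstract total preorder, so that its reversal yields the nearest pebble on the
-- other side.
greatest : ∀ {k} {P : Fin k → Set} → (∀ i → Dec (P i)) → {R : Fin k → Fin k → Set} →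
           (∀ i j → R i j ⊎ R j i) → (∀ {i j l} → R i j → R j l → R i l) →
           ∃ P → ∃ λ i → P i × (∀ j → P j → R j i)
greatest {suc k} {P} P? {R} total tr (w , pw) with any? (λ i → P? (suc i))
... | no none = zero , at-zero w pw , λ { zero _ → reduce (total zero zero) ; (suc j) pj → contradiction (j , pj) none }
  where
  at-zero : ∀ w → P w → P zero
  at-zero zero    p = p
  at-zero (suc i) p = contradiction (i , p) none
... | yes some with greatest (λ i → P? (suc i)) {λ i j → R (suc i) (suc j)} (λ i j → total (suc i) (suc j)) tr some | P? zero
... | i , pi , max | no ¬p0 = suc i , pi , λ { zero p → contradiction p ¬p0 ; (suc j) pj → max j pj }
... | i , pi , max | yes p0 with total (suc i) zero
... | inj₁ r = zero , p0 , λ { zero _ → reduce (total zero zero) ; (suc j) pj → tr (max j pj) r }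
... | inj₂ r = suc i , pi , λ { zero _ → r ; (suc j) pj → max j pj }

-- The truncated difference `A j ∸ A i` vanishes iff `A j ≤ A i`, so for positive `t` closeness in
-- both directions preserves the order too.
record Similar (t : ℕ) {k} (A B : Fin k → ℕ) : Set where
  constructor similar
  field distances : ∀ i j → Close t (A j ∸ A i) (B j ∸ B i)
open Similar

similar-sym : ∀ {t k} {A B : Fin k → ℕ} → Similar t A B → Similar t B A
similar-sym sim = similar λ i j → close-sym (distances sim i j)

similar-≤ : ∀ {t k} {A B : Fin k → ℕ} → 0 < t → Similar t A B → ∀ i j → A i ≤ A j → B i ≤ B j
similar-≤ 0<t sim i j le with distances sim j i
... | inj₁ e       = m∸n≡0⇒m≤n (trans (sym e) (m≤n⇒m∸n≡0 le))
... | inj₂ (p , _) = contradiction (≤-trans 0<t (≤-trans p (≤-reflexive (m≤n⇒m∸n≡0 le)))) λ ()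

similar-< : ∀ {t k} {A B : Fin k → ℕ} → 0 < t → Similar t A B → ∀ i j → A i < A j → B i < B j
similar-< 0<t sim i j A< = ≰⇒> λ le → <⇒≱ A< (similar-≤ 0<t (similar-sym sim) j i le)

∸-split : ∀ {a b c} → a ≤ b → b ≤ c → c ∸ a ≡ (c ∸ b) + (b ∸ a)
∸-split {a} {b} {c} a≤b b≤c =
  trans (cong (_∸ a) (sym (m∸n+n≡m b≤c))) (+-∸-assoc (c ∸ b) a≤b)

close-∸-trans : ∀ {t a b c a′ b′ c′} → a ≤ b → b ≤ c → a′ ≤ b′ → b′ ≤ c′ →
                Close t (b ∸ a) (b′ ∸ a′) → Close t (c ∸ b) (c′ ∸ b′) → Close t (c ∸ a) (c′ ∸ a′)
close-∸-trans {t} p q p′ q′ r s =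
  subst₂ (Close t) (sym (∸-split p q)) (sym (∸-split p′ q′)) (close-+ s r)

close-zero : ∀ {t a b a′ b′} → a ≤ b → a′ ≤ b′ → Close t (a ∸ b) (a′ ∸ b′)
close-zero p q = inj₁ (trans (m≤n⇒m∸n≡0 p) (sym (m≤n⇒m∸n≡0 q)))

-- One round of the Ehrenfeucht–Fraïssé game: only the two pebbles nearest to x matter.
similar-extend : ∀ {t k} {A B : Fin k → ℕ} → 0 < t → Similar (2 * t) A B →
                 ∀ x (lo hi : Fin k) → A lo ≤ x → x ≤ A hi → ∃ λ y → Similar t (x Vector.∷ A) (y Vector.∷ B)
similar-extend {t} {k} {A} {B} 0<t sim x lo hi lo≤x x≤hi
  with greatest (λ i → A i ≤? x) {λ i j → A i ≤ A j} (λ i j → ≤-total (A i) (A j)) ≤-trans (lo , lo≤x)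
     | greatest (λ i → x ≤? A i) {λ i j → A j ≤ A i} (λ i j → ≤-total (A j) (A i)) (λ p q → ≤-trans q p) (hi , x≤hi)
... | l , l≤x , lmax | r , x≤r , rmin
  with close-split t (x ∸ A l) (A r ∸ x) {B r ∸ B l}
         (subst (λ D → Close (2 * t) D (B r ∸ B l))
                (trans (∸-split l≤x x≤r) (+-comm (A r ∸ x) (x ∸ A l))) (distances sim l r))
... | d′ , e′ , d′+e′≡ , cd , ce = y , similar sim′
  where
  0<2t : 0 < 2 * t
  0<2t = ≤-trans 0<t (m≤m+n t _)
  mono : ∀ i j → A i ≤ A j → B i ≤ B j
  mono = similar-≤ 0<2t sim
  weak : ∀ i j → Close t (A j ∸ A i) (B j ∸ B i)
  weak i j = close-weaken (m≤m+n t _) (distances sim i j)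
  y : ℕ
  y = B l + d′
  y+e′ : y + e′ ≡ B r
  y+e′ = trans (+-assoc (B l) d′ e′)
               (trans (cong (B l +_) d′+e′≡) (m+[n∸m]≡n (mono l r (≤-trans l≤x x≤r))))
  l≤y : B l ≤ y
  l≤y = m≤m+n _ _
  y≤r : y ≤ B r
  y≤r = subst (y ≤_) y+e′ (m≤m+n y e′)
  closel : Close t (x ∸ A l) (y ∸ B l)
  closel = subst (Close t (x ∸ A l)) (sym (m+n∸m≡n (B l) d′)) cd
  closer : Close t (A r ∸ x) (B r ∸ y)
  closer = subst (Close t (A r ∸ x)) (trans (sym (m+n∸m≡n y e′)) (cong (_∸ y) y+e′)) ce
  below : ∀ i → A i ≤ x → Close t (x ∸ A i) (y ∸ B i) × B i ≤ y
  below i p = close-∸-trans (lmax i p) l≤x (mono i l (lmax i p)) l≤y (weak i l) closel ,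
              ≤-trans (mono i l (lmax i p)) l≤y
  above : ∀ i → x ≤ A i → Close t (A i ∸ x) (B i ∸ y) × y ≤ B i
  above i p = close-∸-trans x≤r (rmin i p) y≤r (mono r i (rmin i p)) closer (weak r i) ,
              ≤-trans y≤r (mono r i (rmin i p))
  sim′ : ∀ i j → Close t ((x Vector.∷ A) j ∸ (x Vector.∷ A) i) ((y Vector.∷ B) j ∸ (y Vector.∷ B) i)
  sim′ zero zero = close-zero {a = x} {a′ = y} ≤-refl ≤-refl
  sim′ zero (suc j) with ≤-total (A j) x
  ... | inj₁ p = close-zero p (proj₂ (below j p))
  ... | inj₂ p = proj₁ (above j p)
  sim′ (suc i) zero with ≤-total (A i) x
  ... | inj₁ p = proj₁ (below i p)
  ... | inj₂ p = close-zero p (proj₂ (above i p))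
  sim′ (suc i) (suc j) = weak i j

-- Positions are shifted by one, so that the pebbles at 0 and 2 + N mark the two ends of 𝒜_N.
record Matching (t N N′ : ℕ) {n} (ρ : Fin n → Elem N) (ρ′ : Fin n → Elem N′) : Set where
  field
    {pebbles} : ℕ
    A B   : Fin pebbles → ℕ
    lo hi : Fin pebbles
    A-lo  : A lo ≡ 0
    B-lo  : B lo ≡ 0
    A-hi  : A hi ≡ 2 + N
    B-hi  : B hi ≡ 2 + N′
    sim   : Similar t A B
    place : Fin n → Fin pebbles
    A-place : ∀ x → A (place x) ≡ suc (toℕ (ρ x))
    B-place : ∀ x → B (place x) ≡ suc (toℕ (ρ′ x))

module _ {t N N′ n : ℕ} {ρ : Fin n → Elem N} {ρ′ : Fin n → Elem N′} where

  matching-sym : Matching t N N′ ρ ρ′ → Matching t N′ N ρ′ ρ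
  matching-sym m = record
    { A = B ; B = A ; lo = lo ; hi = hi ; A-lo = B-lo ; B-lo = A-lo ; A-hi = B-hi ; B-hi = A-hi
    ; sim = similar-sym sim ; place = place ; A-place = B-place ; B-place = A-place }
    where open Matching m

  matching-< : 0 < t → Matching t N N′ ρ ρ′ → ∀ x y → toℕ (ρ x) < toℕ (ρ y) → toℕ (ρ′ x) < toℕ (ρ′ y)
  matching-< 0<t m x y ρ< = s≤s⁻¹ (subst₂ _<_ (B-place x) (B-place y)
      (similar-< 0<t sim (place x) (place y) (subst₂ _<_ (sym (A-place x)) (sym (A-place y)) (s≤s ρ<))))
    where open Matching m

  -- The response lies strictly between the two end pebbles and is therefore the shift of a genuine
  -- element.
  matching-extend : 0 < t → Matching (2 * t) N N′ ρ ρ′ → ∀ a →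
                    ∃ λ b → Matching t N N′ (extend N ρ a) (extend N′ ρ′ b)
  matching-extend 0<t m a = finish y sim′ 0<y y<hi
    where
    open Matching m
    a<hi : suc (toℕ a) < A hi
    a<hi = subst (suc (toℕ a) <_) (sym A-hi) (s≤s (toℕ<n a))
    ext = similar-extend 0<t sim (suc (toℕ a)) lo hi (subst (_≤ _) (sym A-lo) z≤n) (<⇒≤ a<hi)
    y    = proj₁ ext
    sim′ = proj₂ ext
    0<y : 0 < y
    0<y = subst (_< y) B-lo (similar-< 0<t sim′ (suc lo) zero (subst (_< _) (sym A-lo) (s≤s z≤n)))
    y<hi : y < 2 + N′
    y<hi = subst (y <_) B-hi (similar-< 0<t sim′ zero (suc hi) a<hi)
    finish : ∀ y → Similar t (suc (toℕ a) Vector.∷ A) (y Vector.∷ B) → 0 < y → y < 2 + N′ →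
             ∃ λ b → Matching t N N′ (extend N ρ a) (extend N′ ρ′ b)
    finish (suc b) sim″ _ (s≤s b<) = fromℕ< b< , record
      { A = suc (toℕ a) Vector.∷ A ; B = suc b Vector.∷ B ; lo = suc lo ; hi = suc hi
      ; A-lo = A-lo ; B-lo = B-lo ; A-hi = A-hi ; B-hi = B-hi ; sim = sim″
      ; place = λ { zero → zero ; (suc x) → suc (place x) }
      ; A-place = λ { zero → refl ; (suc x) → A-place x }
      ; B-place = λ { zero → cong suc (sym (toℕ-fromℕ< b<)) ; (suc x) → B-place x } }

-- Each quantifier costs one round of the game and halves the threshold, and there are at most
-- `size φ` of them. Negation and `all` use the symmetric matching: the game is played from the
-- other side.
transfer : ∀ {N N′ n q S S′} {ρ : Fin n → Elem N} {ρ′ : Fin n → Elem N′} (φ : Fm 0 n) →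
           size φ ≤ q → Matching (2 ^ q) N N′ ρ ρ′ → Sat N S ρ φ → Sat N′ S′ ρ′ φ
transfer {q = q} (lt x y) _ m s = matching-< (m^n>0 2 q) m x y s
transfer {q = q} {ρ = ρ} {ρ′} (eq x y) _ m s =
  toℕ-injective (≤-antisym (≮⇒≥ (back y x (≤-reflexive (cong toℕ s)))) (≮⇒≥ (back x y (≤-reflexive (cong toℕ (sym s))))))
  where
  back : ∀ x y → toℕ (ρ y) ≤ toℕ (ρ x) → ¬ (toℕ (ρ′ x) < toℕ (ρ′ y))
  back x y le lt′ = <⇒≱ (matching-< (m^n>0 2 q) (matching-sym m) x y lt′) le
transfer (neg φ) sz m s = λ s′ → s (transfer φ (<⇒≤ sz) (matching-sym m) s′)
transfer (and φ ψ) sz m (s , s′) =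
  transfer φ (≤-trans (m≤m+n _ _) (<⇒≤ sz)) m s , transfer ψ (≤-trans (m≤n+m _ _) (<⇒≤ sz)) m s′
transfer (or φ ψ) sz m (inj₁ s) = inj₁ (transfer φ (≤-trans (m≤m+n _ _) (<⇒≤ sz)) m s)
transfer (or φ ψ) sz m (inj₂ s) = inj₂ (transfer ψ (≤-trans (m≤n+m _ _) (<⇒≤ sz)) m s)
transfer {q = suc q} (ex φ) (s≤s sz) m (a , s) =
  let b , m′ = matching-extend (m^n>0 2 q) m a in b , transfer φ sz m′ s
transfer {q = suc q} (all φ) (s≤s sz) m s = λ b →
  let a , m′ = matching-extend (m^n>0 2 q) (matching-sym m) b in transfer φ sz (matching-sym m′) (s a)

long-orders-agree : ∀ {N N′} (ψ : FOSentence) → 2 ^ size ψ ≤ 2 + N → 2 ^ size ψ ≤ 2 + N′ → ⊨FO N ψ → ⊨FO N′ ψ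
long-orders-agree {N} {N′} ψ p q = transfer ψ ≤-refl record
  { A = 0 Vector.∷ 2 + N Vector.∷ Vector.[] ; B = 0 Vector.∷ 2 + N′ Vector.∷ Vector.[] ; lo = zero ; hi = suc zero
  ; A-lo = refl ; B-lo = refl ; A-hi = refl ; B-hi = refl
  ; sim = similar λ { zero zero → inj₁ refl ; zero (suc zero) → inj₂ (p , q) ; (suc zero) zero → inj₁ refl
            ; (suc zero) (suc zero) → close-zero {a = N} {a′ = N′} ≤-refl ≤-refl }
  ; place = λ () ; A-place = λ () ; B-place = λ () }

-- The sentences Φ h

-- Universes are finite. Decidability serves to introduce implications, which are disjunctions here.
Sat? : ∀ N {k n} S (ρ : Fin n → Elem N) (φ : Fm k n) → Dec (Sat N S ρ φ)
Sat? N S ρ (lt x y)  = toℕ (ρ x) <? toℕ (ρ y)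
Sat? N S ρ (eq x y)  = ρ x ≟F ρ y
Sat? N S ρ (mem X x) = S X (ρ x) Bool.≟ true
Sat? N S ρ (neg φ)   = ¬? (Sat? N S ρ φ)
Sat? N S ρ (and φ ψ) = Sat? N S ρ φ ×-dec Sat? N S ρ ψ
Sat? N S ρ (or φ ψ)  = Sat? N S ρ φ ⊎-dec Sat? N S ρ ψ
Sat? N S ρ (ex φ)    = any? (λ a → Sat? N S (extend N ρ a) φ)
Sat? N S ρ (all φ)   = all? (λ a → Sat? N S (extend N ρ a) φ)

imp : ∀ {k n} → Fm k n → Fm k n → Fm k n
imp φ ψ = or (neg φ) ψ

imp-intro : ∀ {A B : Set} → Dec A → (A → B) → ¬ A ⊎ B
imp-intro (yes a) f = inj₂ (f a)
imp-intro (no ¬a) _ = inj₁ ¬a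

imp-elim : ∀ {A B : Set} → ¬ A ⊎ B → A → B
imp-elim (inj₁ ¬a) a = contradiction a ¬a
imp-elim (inj₂ b)  _ = b

-- Truncated to the last element of Fin (suc m) outside the range.
clamp : ∀ {m} → ℕ → Fin (suc m)
clamp {zero}  _       = zero
clamp {suc m} zero    = zero
clamp {suc m} (suc i) = suc (clamp i)

toℕ-clamp : ∀ {m i} → i ≤ m → toℕ (clamp {m} i) ≡ i
toℕ-clamp {zero}  z≤n       = refl
toℕ-clamp {suc m} z≤n       = refl
toℕ-clamp {suc m} (s≤s i≤m) = cong suc (toℕ-clamp i≤m)

-- The set variable with index i holds the positions of level at least i.
level≥ : ∀ {m n} → ℕ → Fin n → Fm (suc m) n
level≥ i x = mem (clamp i) x

-- The forbidden positions of higher level range from `z` inclusive up to `x` exclusive; including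
-- `z` forces its level to be exactly `i`.
child : ∀ {m n} → ℕ → Fin n → Fin n → Fm (suc m) n
child i z x = and (lt z x) (and (level≥ i z)
  (neg (ex (and (neg (lt zero (suc z))) (and (lt zero (suc x)) (level≥ (suc i) zero))))))

-- Equality of the hereditarily finite sets of rank i coded at x and y; a single quantifier
-- pair serves both inclusions, so that the recursive call occurs only once.
same : ∀ {m n} → ℕ → Fin n → Fin n → Fm (suc m) n
same zero    x y = eq x x
same (suc i) x y = all (ex (and (imp (child i z x′) (child i w y′))
                           (and (imp (child i z y′) (child i w x′)) (same i z w))))
  where
  z  = suc zero
  w  = zero
  x′ = suc (suc x)
  y′ = suc (suc y)

-- `child` does not look at the level of its second argument. With `w` of level exactly `i`, it says
-- that `w` continues the list to which `z` belongs.
siblings : ∀ {m n} → ℕ → Fin n → Fin n → Fm (suc m) n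
siblings i z w = and (child i z w) (and (level≥ i w) (neg (level≥ (suc i) w)))

distinctSiblings : ∀ {m} → ℕ → Fm (suc m) 0
distinctSiblings i =
  all (all (imp (siblings i (suc zero) zero) (neg (same i (suc zero) zero))))

distinctUpTo : ∀ {m} → ℕ → Fm (suc m) 0
distinctUpTo zero    = distinctSiblings zero
distinctUpTo (suc i) = and (distinctSiblings (suc i)) (distinctUpTo i)

Φ : ℕ → MonΣ11
-- The last set variable, with index `suc h`, is forced to be empty, so that `level≥ (suc i)` makes
-- sense up to `i = h`.
Φ h = mon (2 + h) (and (all (and (level≥ 0 zero) (neg (level≥ (suc h) zero)))) (distinctUpTo h))

size-same : ∀ {m n} i (x y : Fin n) → size (same {m} i x y) ≡ 1 + i * 56
size-same zero    x y = refl
size-same {m} (suc i) x y = cong (56 +_) (size-same {m} i (suc zero) zero)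

size-distinctSiblings : ∀ {m} i → size (distinctSiblings {m} i) ≡ 23 + i * 56
size-distinctSiblings {m} i = cong (22 +_) (size-same {m} i (suc (zero {0})) zero)

size-distinctUpTo : ∀ {m} h → size (distinctUpTo {m} h) ≤ suc h * (24 + h * 56)
size-distinctUpTo {m} zero = ≤-trans (≤-reflexive (size-distinctSiblings {m} 0)) (m≤m+n 23 1)
size-distinctUpTo {m} (suc h) = begin
  suc (size (distinctSiblings {m} (suc h)) + size (distinctUpTo {m} h))
    ≤⟨ s≤s (+-mono-≤ (≤-reflexive (size-distinctSiblings {m} (suc h))) (size-distinctUpTo {m} h)) ⟩
  24 + suc h * 56 + suc h * (24 + h * 56)
    ≤⟨ +-monoʳ-≤ (24 + suc h * 56) (*-monoʳ-≤ (suc h) (+-monoʳ-≤ 24 (*-monoˡ-≤ 56 (n≤1+n h)))) ⟩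
  suc (suc h) * (24 + suc h * 56) ∎
  where open ≤-Reasoning

sizeΣ-Φ : ∀ h → sizeΣ (Φ h) ≤ 100 * (suc h * suc h)
sizeΣ-Φ h = begin
  sizeΣ (Φ h)                                ≤⟨ +-monoʳ-≤ (2 + h) (+-monoʳ-≤ 6 (size-distinctUpTo {suc h} h)) ⟩
  -- The added polynomial is the exact gap to the bound, whose factor 100 is a square for the later
  -- extraction of roots.
  (2 + h) + (6 + suc h * (24 + h * 56))      ≤⟨ m≤m+n _ (44 * (h * h) + 119 * h + 68) ⟩
  ((2 + h) + (6 + suc h * (24 + h * 56))) + (44 * (h * h) + 119 * h + 68) ≡⟨ expand h ⟩
  100 * (suc h * suc h)                      ∎
  where
  open ≤-Reasoning
  expand : ∀ h → ((2 + h) + (6 + suc h * (24 + h * 56))) + (44 * (h * h) + 119 * h + 68) ≡ 100 * (suc h * suc h)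
  expand = solve-∀

distinct-at : ∀ {N m S ρ} i h → i ≤ h → Sat N S ρ (distinctUpTo {m} h) → Sat N S ρ (distinctSiblings i)
distinct-at i zero    z≤n s = s
distinct-at i (suc h) i≤h s with m≤n⇒m<n∨m≡n i≤h
... | inj₁ i<h  = distinct-at i h (s≤s⁻¹ i<h) (proj₂ s)
... | inj₂ refl = proj₁ s

-- Upper bound on the length of models of `Φ h`

blockLength : ℕ → ℕ
blockLength zero    = 1
blockLength (suc i) = suc (Tower i) * blockLength i

module Bound {N m : ℕ} (S : Fin (suc m) → Elem N → Bool) where

  pair : Elem N → Elem N → Fin 2 → Elem N
  pair x y zero       = x
  pair x y (suc zero) = y

  L : ℕ → Elem N → Set
  L i x = S (clamp i) x ≡ true

  IsChild : ℕ → Elem N → Elem N → Set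
  IsChild i z x = Sat N S (pair z x) (child i zero (suc zero))

  isChild? : ∀ i z x → Dec (IsChild i z x)
  isChild? i z x = Sat? N S (pair z x) (child i zero (suc zero))

  bit : ∀ {A : Set} → Dec A → Fin 2
  bit (yes _) = suc zero
  bit (no _)  = zero

  bit-transfer : ∀ {A B : Set} (a : Dec A) (b : Dec B) → bit a ≡ bit b → A → B
  bit-transfer _        (yes y) _ _ = y
  bit-transfer (no ¬x)  (no _)  _ x = contradiction x ¬x

  member? : ∀ i (c : Elem N → Fin (Tower i)) x k →
            Dec (∃ λ z → IsChild i z x × c z ≡ k)
  member? i c x k = any? (λ z → isChild? i z x ×-dec (c z ≟F k))

  -- The set at `x` as a bit vector: bit `k` records whether some child has code `k`. There are
  -- `2 ^ Tower i` such vectors, which is `Tower (suc i)`.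
  code : ∀ i → Elem N → Fin (Tower i)
  code zero    x = zero
  code (suc i) x = funToFin (λ k → bit (member? i (code i) x k))

  same-code : ∀ i x y → code (suc i) x ≡ code (suc i) y → ∀ z →
              IsChild i z x →
              ∃ λ w → IsChild i w y × code i w ≡ code i z
  same-code i x y e z c =
    bit-transfer (member? i (code i) x (code i z)) (member? i (code i) y (code i z)) e′ (z , c , refl)
    where
    f : Elem N → Fin (Tower i) → Fin 2
    f x k = bit (member? i (code i) x k)
    e′ : f x (code i z) ≡ f y (code i z)
    e′ = trans (sym (finToFun-funToFin (f x) (code i z)))
               (trans (cong (λ c → finToFun c (code i z)) e) (finToFun-funToFin (f y) (code i z)))

  -- If `z` is a child on one side only, the codes supply `w` on the other; otherwise `w = z`
  -- answers both implications.
  code⇒same : ∀ i {n} (ρ : Fin n → Elem N) x y → code i (ρ x) ≡ code i (ρ y) → Sat N S ρ (same i x y)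
  code⇒same zero    ρ x y e = refl
  code⇒same (suc i) ρ x y e z with isChild? i z (ρ x) | isChild? i z (ρ y)
  ... | yes cx | no ¬cy = let w , c , e′ = same-code i (ρ x) (ρ y) e z cx in
        w , inj₂ c , inj₁ ¬cy , code⇒same i _ (suc zero) zero (sym e′)
  ... | no ¬cx | yes cy = let w , c , e′ = same-code i (ρ y) (ρ x) (sym e) z cy in
        w , inj₁ ¬cx , inj₂ c , code⇒same i _ (suc zero) zero (sym e′)
  ... | yes cx | yes cy = z , inj₂ cy , inj₂ cx , code⇒same i _ (suc zero) zero refl
  ... | no ¬cx | no ¬cy = z , inj₁ ¬cx , inj₁ ¬cy , code⇒same i _ (suc zero) zero refl

  In : ℕ → ℕ → Elem N → Set
  In a b x = a ≤ toℕ x × toℕ x < a + b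

  -- `blockLength` is chosen to make this inductive: one position suffices at level 0, and
  -- `suc (Tower i)` blocks force a repeated code unless a higher level intervenes.
  Meets : ℕ → Set
  Meets i = ∀ a → a + blockLength i ≤ suc N → ∃ λ x → In a (blockLength i) x × L i x

  -- Otherwise 1 + Tower i consecutive blocks contain as many level-i siblings, two of which
  -- have the same code.
  meets-suc : ∀ {ρ} i → Sat N S ρ (distinctSiblings i) → Meets i → Meets (suc i)
  meets-suc i distinct meets a a+b≤
    with any? (λ x → ((a ≤? toℕ x) ×-dec (toℕ x <? a + blockLength (suc i))) ×-dec (S (clamp (suc i)) x Bool.≟ true))
  ... | yes found = found
  ... | no none = contradiction (imp-elim (distinct z w) ((z<w , Lz , between) , Lw , none-at w in-w))
                                (λ ¬same → ¬same (code⇒same i _ (suc zero) zero ez))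
    where
    b = blockLength i
    start : Fin (suc (Tower i)) → ℕ
    start k = a + toℕ k * b
    end≤ : ∀ k → start k + b ≤ a + suc (Tower i) * b
    end≤ k = begin
      a + toℕ k * b + b     ≡⟨ +-assoc a _ b ⟩
      a + (toℕ k * b + b)   ≡⟨ cong (a +_) (+-comm _ b) ⟩
      a + suc (toℕ k) * b   ≤⟨ +-monoʳ-≤ a (*-monoˡ-≤ b (toℕ<n k)) ⟩
      a + suc (Tower i) * b ∎
      where open ≤-Reasoning
    pick : ∀ k → ∃ λ x → In (start k) b x × L i x
    pick k = meets (start k) (≤-trans (end≤ k) a+b≤)
    in-block : ∀ k → In a (blockLength (suc i)) (proj₁ (pick k))
    in-block k = let _ , (p , q) , _ = pick k in
      ≤-trans (m≤m+n a _) p , ≤-trans q (end≤ k)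
    none-at : ∀ x → In a (blockLength (suc i)) x → ¬ L (suc i) x
    none-at x p l = none (x , p , l)
    php = pigeonhole {Tower i} (n<1+n _) (λ k → code i (proj₁ (pick k)))
    j = proj₁ php
    k = proj₁ (proj₂ php)
    j<k = proj₁ (proj₂ (proj₂ php))
    ez = proj₂ (proj₂ (proj₂ php))
    z = proj₁ (pick j)
    w = proj₁ (pick k)
    Lz = proj₂ (proj₂ (pick j))
    Lw = proj₂ (proj₂ (pick k))
    in-z = in-block j
    in-w = in-block k
    z<w : toℕ z < toℕ w
    z<w = begin-strict
      toℕ z               <⟨ proj₂ (proj₁ (proj₂ (pick j))) ⟩
      a + toℕ j * b + b   ≡⟨ +-assoc a _ b ⟩
      a + (toℕ j * b + b) ≡⟨ cong (a +_) (+-comm _ b) ⟩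
      a + suc (toℕ j) * b ≤⟨ +-monoʳ-≤ a (*-monoˡ-≤ b j<k) ⟩
      a + toℕ k * b       ≤⟨ proj₁ (proj₁ (proj₂ (pick k))) ⟩
      toℕ w               ∎
      where open ≤-Reasoning
    between : ¬ (Σ (Elem N) λ u → ¬ (toℕ u < toℕ z) × toℕ u < toℕ w × L (suc i) u)
    between (u , u≮z , u<w , l) =
      none-at u (≤-trans (proj₁ in-z) (≮⇒≥ u≮z) , <-trans u<w (proj₂ in-w)) l

-- The window starting at 0 would have to meet level `suc h`, which `ends` forbids.
Φ-bounded : ∀ h N → blockLength (suc h) ≤ suc N → ¬ ⊨Σ N (Φ h)
Φ-bounded h N big (S , ends , distinct) =
  let x , _ , l = meets (suc h) ≤-refl 0 big in proj₂ (ends x) l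
  where
  open Bound S
  meets : ∀ i → i ≤ suc h → Meets i
  meets zero    _   a a+1≤ =
    fromℕ< a< , (≤-reflexive (sym e) , subst (_< a + 1) (sym e) (≤-reflexive (+-comm 1 a))) , proj₁ (ends (fromℕ< a<))
    where
    a< = ≤-trans (≤-reflexive (+-comm 1 a)) a+1≤
    e = toℕ-fromℕ< a<
  meets (suc i) i< = meets-suc i (distinct-at i h (s≤s⁻¹ i<) distinct) (meets i (<⇒≤ i<))

-- A model of Φ h with at least Tower h elements

HF : ℕ → Set
HF zero    = ⊤
HF (suc i) = List (HF i)

SameSet : ∀ i → HF i → HF i → Set
SameSet zero    _  _  = ⊤
SameSet (suc i) xs ys = (∀ x → x ∈ xs → ∃ λ y → y ∈ ys × SameSet i x y)
                      × (∀ y → y ∈ ys → ∃ λ x → x ∈ xs × SameSet i x y)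

sameSet-sym : ∀ i {x y} → SameSet i x y → SameSet i y x
sameSet-sym zero    _       = tt
sameSet-sym (suc i) (f , g) =
  (λ y y∈ → let x , x∈ , e = g y y∈ in x , x∈ , sameSet-sym i e) ,
  (λ x x∈ → let y , y∈ , e = f x x∈ in y , y∈ , sameSet-sym i e)

-- The arguments are swapped because a later entry of a list is written earlier in the word and
-- hence comes first in `same`.
Distinct : ∀ i → HF i → HF i → Set
Distinct i x y = ¬ SameSet i y x

WellFormed : ∀ i → HF i → Set
WellFormed zero    _  = ⊤
WellFormed (suc i) xs = All (WellFormed i) xs × AllPairs (Distinct i) xs

sublists : ∀ {A : Set} → List A → List (List A)
sublists []       = [ [] ]
sublists (x ∷ xs) = map (x ∷_) (sublists xs) ++ sublists xs

length-sublists : ∀ {A : Set} (xs : List A) → length (sublists xs) ≡ 2 ^ length xs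
length-sublists []       = refl
length-sublists (x ∷ xs) = trans (length-++ (map (x ∷_) (sublists xs)))
  (cong₂ _+_ (trans (length-map (x ∷_) (sublists xs)) (length-sublists xs))
             (trans (length-sublists xs) (sym (+-identityʳ _))))

sublists-All : ∀ {A : Set} {P : A → Set} {xs} → All P xs → All (All P) (sublists xs)
sublists-All []       = [] ∷ []
sublists-All (p ∷ ps) = All.++⁺ (All.map⁺ (All.map (p ∷_) (sublists-All ps))) (sublists-All ps)

sublists-AllPairs : ∀ {A : Set} {R : A → A → Set} {xs} → AllPairs R xs → All (AllPairs R) (sublists xs)
sublists-AllPairs []       = [] ∷ []
sublists-AllPairs (r ∷ rs) =
  All.++⁺ (All.map⁺ (All.zipWith (λ (p , q) → p ∷ q) (sublists-All r , sublists-AllPairs rs)))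
          (sublists-AllPairs rs)

module _ {i : ℕ} {x : HF i} where

  distinct-new : ∀ {as bs} → All (Distinct i x) bs → Distinct (suc i) (x ∷ as) bs
  distinct-new new (_ , g) = let y , y∈ , e = g x (here refl) in All.lookup new y∈ e

  -- Since `x` equals no entry of the tails, it is never the partner of one, so a matching of the
  -- longer lists restricts to the tails.
  distinct-cons : ∀ {as bs} → All (Distinct i x) as → All (Distinct i x) bs →
                  Distinct (suc i) as bs → Distinct (suc i) (x ∷ as) (x ∷ bs)
  distinct-cons {as} {bs} newa newb d (f , g) = d (f′ , g′)
    where
    f′ : ∀ y → y ∈ bs → ∃ λ z → z ∈ as × SameSet i y z
    f′ y y∈ with f y (there y∈)
    ... | z , here refl , e = contradiction e (All.lookup newb y∈)
    ... | z , there z∈  , e = z , z∈ , e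
    g′ : ∀ z → z ∈ as → ∃ λ y → y ∈ bs × SameSet i y z
    g′ z z∈ with g z (there z∈)
    ... | y , here refl , e = contradiction (sameSet-sym i e) (All.lookup newa z∈)
    ... | y , there y∈  , e = y , y∈ , e

-- Two sublists containing `x` reduce to their tails, and `x` itself separates a sublist containing
-- it from one that does not.
sublists-distinct : ∀ i {xs : List (HF i)} → AllPairs (Distinct i) xs → AllPairs (Distinct (suc i)) (sublists xs)
sublists-distinct i []                 = [] ∷ []
sublists-distinct i {x ∷ xs} (r ∷ rs) =
  AllPairs.++⁺ (AllPairs.map⁺ (zip (sublists-All r) (sublists-distinct i rs))) (sublists-distinct i rs)
               (All.map⁺ (All.map (λ _ → All.map distinct-new (sublists-All r)) (sublists-All r)))
  where
  zip : ∀ {ass} → All (All (Distinct i x)) ass → AllPairs (Distinct (suc i)) ass →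
        AllPairs (λ as bs → Distinct (suc i) (x ∷ as) (x ∷ bs)) ass
  zip []       []       = []
  zip (n ∷ ns) (d ∷ ds) = All.zipWith (λ (m , e) → distinct-cons n m e) (ns , d) ∷ zip ns ds

universe : ∀ i → List (HF i)
universe zero    = [ tt ]
universe (suc i) = sublists (universe i)

length-universe : ∀ i → length (universe i) ≡ Tower i
length-universe zero    = refl
length-universe (suc i) = trans (length-sublists (universe i)) (cong (2 ^_) (length-universe i))

universe-wellFormed : ∀ i → WellFormed (suc i) (universe i)
universe-wellFormed zero    = tt ∷ [] , [] ∷ []
universe-wellFormed (suc i) = let wf , d = universe-wellFormed i in
  All.zip (sublists-All wf , sublists-AllPairs d) , sublists-distinct i d

-- s i is the set coded by a letter i if it is the next one to be read, i.e. s (suc i) lists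
-- the sets coded by the letters i read since the last letter above i.
State : Set
State = ∀ i → HF i

empty : State
empty zero    = tt
empty (suc i) = []

push : ∀ {A B C X : Set} → Tri A B C → X → List X → List X
push (tri< _ _ _) x xs = []
push (tri≈ _ _ _) x xs = x ∷ xs
push (tri> _ _ _) x xs = xs

step : State → ℕ → State
step s l zero    = tt
step s l (suc j) = push (<-cmp j l) (s j) (s (suc j))

step-< : ∀ s {l j} → j < l → step s l (suc j) ≡ []
step-< s {l} {j} j<l with <-cmp j l
... | tri< _ _ _   = refl
... | tri≈ ≮ _ _   = contradiction j<l ≮
... | tri> ≮ _ _   = contradiction j<l ≮

step-≡ : ∀ s l → step s l (suc l) ≡ s l ∷ s (suc l)
step-≡ s l with <-cmp l l
... | tri< _ ≢ _ = contradiction refl ≢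
... | tri≈ _ _ _ = refl
... | tri> _ ≢ _ = contradiction refl ≢

step-> : ∀ s {l j} → l < j → step s l (suc j) ≡ s (suc j)
step-> s {l} {j} l<j with <-cmp j l
... | tri< _ _ ≯ = contradiction l<j ≯
... | tri≈ _ _ ≯ = contradiction l<j ≯
... | tri> _ _ _ = refl

Fresh : State → ∀ i → HF i → Set
Fresh s i x = All (Distinct i x) (s (suc i))

-- The operational counterpart of `distinctSiblings`: each letter must record a set not yet on its
-- list.
Legal : State → List ℕ → Set
Legal s []      = ⊤
Legal s (l ∷ w) = Fresh s l (s l) × Legal (step s l) w

run : State → List ℕ → State
run s []      = s
run s (l ∷ w) = run (step s l) w

run-++ : ∀ s v {w} → run s (v ++ w) ≡ run (run s v) w
run-++ s []      = refl
run-++ s (l ∷ v) = run-++ (step s l) v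

legal-++ : ∀ s v {w} → Legal s v → Legal (run s v) w → Legal s (v ++ w)
legal-++ s []      _       q = q
legal-++ s (l ∷ v) (f , p) q = f , legal-++ (step s l) v p q

-- The tail of a list is written first, because step adds new sets at the front.
word  : ∀ i → HF i → List ℕ
words : ∀ i → List (HF i) → List ℕ
word zero    _  = [ 0 ]
word (suc i) xs = words i xs ++ [ suc i ]
words i []       = []
words i (x ∷ xs) = words i xs ++ word i x

-- Tailored to concatenation: `cleared` is what the next word requires of the lower lists, and
-- `untouched` preserves the siblings collected above.
record Effect (i : ℕ) (xs : List (HF i)) (s : State) (w : List ℕ) : Set where
  field
    legal     : Legal s w
    cleared   : ∀ j → j < i → run s w (suc j) ≡ []
    recorded  : run s w (suc i) ≡ xs
    untouched : ∀ j → i < j → run s w (suc j) ≡ s (suc j)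
open Effect

effect-++ : ∀ {i xs ys s} v {w} → Effect i xs s v → Effect i ys (run s v) w → Effect i ys s (v ++ w)
effect-++ {s = s} v {w} e f = record
  { legal     = legal-++ s v (legal e) (legal f)
  ; cleared   = λ j j<i → trans (cong (λ t → t (suc j)) (run-++ s v)) (cleared f j j<i)
  ; recorded  = trans (cong (λ t → t (suc _)) (run-++ s v)) (recorded f)
  ; untouched = λ j i<j → trans (cong (λ t → t (suc j)) (run-++ s v)) (trans (untouched f j i<j) (untouched e j i<j)) }

-- Mutual induction on the set: `words i xs` assembles `xs` on an empty list, then the letter
-- `suc i` pushes that list as one set and clears it.
word-effect : ∀ i x s → WellFormed i x → (∀ j → j < i → s (suc j) ≡ []) → Fresh s i x →
              Effect i (x ∷ s (suc i)) s (word i x)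
words-effect : ∀ i xs s → WellFormed (suc i) xs → (∀ j → j < suc i → s (suc j) ≡ []) →
               Effect i xs s (words i xs)
word-effect zero x s wf clear fresh = record
  { legal = fresh , tt ; cleared = λ _ () ; recorded = step-≡ s 0 ; untouched = λ j → step-> s }
word-effect (suc i) xs s wf clear fresh = record
  { legal     = legal-++ s (words i xs) (legal e)
                  (subst₂ (λ x ys → All (Distinct (suc i) x) ys) (sym (recorded e)) (sym (untouched e (suc i) ≤-refl)) fresh , tt)
  ; cleared   = λ j j<i → trans (last (suc j)) (step-< s′ j<i)
  ; recorded  = trans (last (2 + i)) (trans (step-≡ s′ (suc i)) (cong₂ _∷_ (recorded e) (untouched e (suc i) ≤-refl)))
  ; untouched = λ j i<j → trans (last (suc j)) (trans (step-> s′ i<j) (untouched e j (<⇒≤ i<j))) }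
  where
  e = words-effect i xs s wf clear
  s′ = run s (words i xs)
  last : ∀ j → run s (words i xs ++ [ suc i ]) j ≡ step s′ (suc i) j
  last j = cong (λ t → t j) (run-++ s (words i xs))
words-effect i [] s wf clear = record
  { legal = tt ; cleared = λ j j<i → clear j (m<n⇒m<1+n j<i) ; recorded = clear i ≤-refl ; untouched = λ _ _ → refl }
words-effect i (x ∷ xs) s (w ∷ ws , d ∷ ds) clear = effect-++ (words i xs) e
  (subst (λ ys → Effect i (x ∷ ys) s′ (word i x)) (recorded e)
    (word-effect i x s′ w (cleared e) (subst (All (Distinct i x)) (sym (recorded e)) d)))
  where
  e = words-effect i xs s (ws , ds) clear
  s′ = run s (words i xs)

word-levels  : ∀ i x → All (_≤ i) (word i x)
words-levels : ∀ i xs → All (_≤ i) (words i xs)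
word-levels zero    x  = z≤n ∷ []
word-levels (suc i) xs = All.++⁺ (All.map m≤n⇒m≤1+n (words-levels i xs)) (≤-refl ∷ [])
words-levels i []       = []
words-levels i (x ∷ xs) = All.++⁺ (words-levels i xs) (word-levels i x)

0<length-word : ∀ i x → 0 < length (word i x)
0<length-word zero    x  = s≤s z≤n
0<length-word (suc i) xs = subst (0 <_) (sym (length-++ (words i xs))) (m≤n+m 1 _)

length-words : ∀ i xs → length xs ≤ length (words i xs)
length-words i []       = z≤n
length-words i (x ∷ xs) = subst₂ _≤_ (+-comm _ 1) (sym (length-++ (words i xs)))
  (+-mono-≤ (length-words i xs) (0<length-word i x))

-- From words to models

letter : List ℕ → ℕ → ℕ
-- The value 0 past the end keeps all letters at most `h`.
letter []      _       = 0
letter (l ∷ w) zero    = l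
letter (l ∷ w) (suc p) = letter w p

stateAt : State → (ℕ → ℕ) → ℕ → State
stateAt s f zero    = s
stateAt s f (suc p) = stateAt (step s (f 0)) (f ∘ suc) p

-- `stateAt` peels letters off the front, as `Legal` does, whereas the inductions in `History` are
-- on the last letter read.
stateAt-suc : ∀ s f p → stateAt s f (suc p) ≡ step (stateAt s f p) (f p)
stateAt-suc s f zero    = refl
stateAt-suc s f (suc p) = stateAt-suc (step s (f 0)) (f ∘ suc) p

legal-at : ∀ s w → Legal s w → ∀ p → p < length w →
           let t = stateAt s (letter w) p in Fresh t (letter w p) (t (letter w p))
legal-at s (l ∷ w) (f , _) zero    _        = f
legal-at s (l ∷ w) (_ , g) (suc p) (s≤s p<) = legal-at (step s l) w g p p<

letter-≤ : ∀ {h w} → All (_≤ h) w → ∀ p → letter w p ≤ h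
letter-≤ []       p       = z≤n
letter-≤ (q ∷ qs) zero    = q
letter-≤ (q ∷ qs) (suc p) = letter-≤ qs p

module History (f : ℕ → ℕ) where

  st : ℕ → State
  st = stateAt empty f

  record ChildAt (i z x : ℕ) : Set where
    field
      z<x   : z < x
      level : f z ≡ i
      low   : ∀ u → z ≤ u → u < x → f u ≤ i

  st-suc : ∀ x i → st (suc x) i ≡ step (st x) (f x) i
  st-suc x i = cong (λ s → s i) (stateAt-suc empty f x)

  -- Position `z` pushes its set, and no later letter up to `i` can clear that list.
  child-recorded : ∀ i z x → ChildAt i z x → st z i ∈ st x (suc i)
  child-recorded i z (suc x) c = subst (st z i ∈_) (sym (st-suc x (suc i))) (go (m≤n⇒m<n∨m≡n (s≤s⁻¹ z<x)))
    where
    open ChildAt c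
    go : z < x ⊎ z ≡ x → st z i ∈ step (st x) (f x) (suc i)
    go (inj₂ refl) = subst (λ l → st z i ∈ step (st z) l (suc i)) (sym level)
                       (subst (st z i ∈_) (sym (step-≡ (st z) i)) (here refl))
    go (inj₁ z<x′) with m≤n⇒m<n∨m≡n (low x (s≤s⁻¹ z<x) ≤-refl)
                      | child-recorded i z x (record { z<x = z<x′ ; level = level ; low = λ u p q → low u p (m<n⇒m<1+n q) })
    ... | inj₁ l<i | p = subst (st z i ∈_) (sym (step-> (st x) l<i)) p
    ... | inj₂ l≡i | p = subst (λ l → st z i ∈ step (st x) l (suc i)) (sym l≡i)
                          (subst (st z i ∈_) (sym (step-≡ (st x) i)) (there p))

  child-suc : ∀ {i z x} → ChildAt i z x → f x ≤ i → ChildAt i z (suc x)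
  child-suc {i} {z} {x} c fx≤i = record { z<x = m<n⇒m<1+n z<x ; level = level ; low = low′ }
    where
    open ChildAt c
    low′ : ∀ u → z ≤ u → u < suc x → f u ≤ i
    low′ u z≤u u<sx with m≤n⇒m<n∨m≡n (s≤s⁻¹ u<sx)
    ... | inj₁ u<x  = low u z≤u u<x
    ... | inj₂ refl = fx≤i

  -- By the last letter: above `i` it leaves an empty list, equal to `i` it is itself the newest
  -- child, below `i` it changes nothing.
  recorded-child : ∀ i x a → a ∈ st x (suc i) → ∃ λ z → ChildAt i z x × a ≡ st z i
  recorded-child i (suc x) a a∈ = go (<-cmp i (f x)) (subst (a ∈_) (st-suc x (suc i)) a∈)
    where
    older : f x ≤ i → a ∈ st x (suc i) → ∃ λ z → ChildAt i z (suc x) × a ≡ st z i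
    older fx≤i p = let z , c , e = recorded-child i x a p in z , child-suc c fx≤i , e
    go : Tri (i < f x) (i ≡ f x) (f x < i) → a ∈ step (st x) (f x) (suc i) → ∃ λ z → ChildAt i z (suc x) × a ≡ st z i
    go (tri< i<l _ _) p with subst (a ∈_) (step-< (st x) i<l) p
    ... | ()
    go (tri> _ _ l<i) p = older (<⇒≤ l<i) (subst (a ∈_) (step-> (st x) l<i) p)
    go (tri≈ _ i≡l _) p with subst (a ∈_) (step-≡ (st x) i) (subst (λ l → a ∈ step (st x) l (suc i)) (sym i≡l) p)
    ... | there q   = older (≤-reflexive (sym i≡l)) q
    ... | here refl = x , record { z<x = ≤-refl ; level = sym i≡l
                                 ; low = λ u x≤u u<sx → ≤-reflexive (trans (cong f (≤-antisym (s≤s⁻¹ u<sx) x≤u)) (sym i≡l)) } , refl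

module Model (h N : ℕ) (f : ℕ → ℕ) (f≤h : ∀ p → f p ≤ h) where
  open History f

  S : Fin (2 + h) → Elem N → Bool
  S k x = toℕ k ≤ᵇ f (toℕ x)

  level⇒ : ∀ {i} x → i ≤ suc h → S (clamp i) x ≡ true → i ≤ f (toℕ x)
  level⇒ {i} x i≤ e = subst (_≤ f (toℕ x)) (toℕ-clamp i≤) (≤ᵇ⇒≤ _ _ (Equivalence.from Bool.T-≡ e))

  level⇐ : ∀ {i} x → i ≤ suc h → i ≤ f (toℕ x) → S (clamp i) x ≡ true
  level⇐ {i} x i≤ p = Equivalence.to Bool.T-≡ (≤⇒≤ᵇ (subst (_≤ f (toℕ x)) (sym (toℕ-clamp i≤)) p))

  module _ {n : ℕ} (ρ : Fin n → Elem N) where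

    child⇒ : ∀ {i} z x → i ≤ h → Sat N S ρ (child i z x) → ChildAt i (toℕ (ρ z)) (toℕ (ρ x))
    child⇒ {i} z x i≤h (z<x , lz , none) = record
      { z<x = z<x
      -- Taking `u = z` bounds the level of `z` from above.
      ; level = ≤-antisym (low′ (ρ z) ≤-refl z<x) (level⇒ (ρ z) (m≤n⇒m≤1+n i≤h) lz)
      ; low = λ u z≤u u<x → let u< = <-trans u<x (toℕ<n (ρ x)) in
          subst (λ u → f u ≤ i) (toℕ-fromℕ< u<)
            (low′ (fromℕ< u<) (subst (toℕ (ρ z) ≤_) (sym (toℕ-fromℕ< u<)) z≤u) (subst (_< toℕ (ρ x)) (sym (toℕ-fromℕ< u<)) u<x)) }
      where
      low′ : ∀ u → toℕ (ρ z) ≤ toℕ u → toℕ u < toℕ (ρ x) → f (toℕ u) ≤ i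
      low′ u z≤u u<x = ≮⇒≥ λ i<l → none (u , ≤⇒≯ z≤u , u<x , level⇐ u (s≤s i≤h) i<l)

    child⇐ : ∀ {i} z x → i ≤ h → ChildAt i (toℕ (ρ z)) (toℕ (ρ x)) → Sat N S ρ (child i z x)
    child⇐ {i} z x i≤h c =
      z<x , level⇐ (ρ z) (m≤n⇒m≤1+n i≤h) (≤-reflexive (sym level)) ,
      λ { (u , u≮z , u<x , l) → <⇒≱ (level⇒ u (s≤s i≤h) l) (low (toℕ u) (≮⇒≥ u≮z) u<x) }
      where open ChildAt c

  -- Recorded sets correspond to children, so the two implications about `z` and `w` yield the two
  -- inclusions.
  same⇒ : ∀ i {n} (ρ : Fin n → Elem N) x y → i ≤ suc h → Sat N S ρ (same i x y) →
          SameSet i (st (toℕ (ρ x)) i) (st (toℕ (ρ y)) i)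
  same⇒ zero    ρ x y _ _ = tt
  same⇒ (suc i) ρ x y (s≤s i≤h) s = left , right
    where
    elem : ∀ {a} v → a ∈ st (toℕ (ρ v)) (suc i) → ∃ λ z → ChildAt i (toℕ z) (toℕ (ρ v)) × a ≡ st (toℕ z) i
    elem v a∈ = let z , c , e = recorded-child i _ _ a∈
                    z< = <-trans (ChildAt.z<x c) (toℕ<n (ρ v))
                    eq = sym (toℕ-fromℕ< z<) in
      fromℕ< z< , subst (λ z → ChildAt i z _) eq c , trans e (cong (λ z → st z i) eq)
    left : ∀ a → a ∈ st (toℕ (ρ x)) (suc i) → ∃ λ b → b ∈ st (toℕ (ρ y)) (suc i) × SameSet i a b
    left a a∈ with elem x a∈
    ... | z , c , refl =
      let w , xy , _ , e = s z
          ρ′ = extend N (extend N ρ z) w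
          d = child⇒ ρ′ zero (suc (suc y)) i≤h (imp-elim xy (child⇐ ρ′ (suc zero) (suc (suc x)) i≤h c))
      in _ , child-recorded i _ _ d , same⇒ i ρ′ (suc zero) zero (m≤n⇒m≤1+n i≤h) e
    right : ∀ b → b ∈ st (toℕ (ρ y)) (suc i) → ∃ λ a → a ∈ st (toℕ (ρ x)) (suc i) × SameSet i a b
    right b b∈ with elem y b∈
    ... | z , c , refl =
      let w , _ , yx , e = s z
          ρ′ = extend N (extend N ρ z) w
          d = child⇒ ρ′ zero (suc (suc x)) i≤h (imp-elim yx (child⇐ ρ′ (suc zero) (suc (suc y)) i≤h c))
      -- The formula compares the given `z` with the found `w` in this order, which this inclusion
      -- needs reversed.
      in _ , child-recorded i _ _ d , sameSet-sym i (same⇒ i ρ′ (suc zero) zero (m≤n⇒m≤1+n i≤h) e)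

  module _ (fresh : ∀ p → p ≤ N → Fresh (st p) (f p) (st p (f p))) where

    fresh-at : ∀ {i} (x : Elem N) → f (toℕ x) ≡ i → Fresh (st (toℕ x)) i (st (toℕ x) i)
    fresh-at x refl = fresh (toℕ x) (s≤s⁻¹ (toℕ<n x))

    distinctSiblings-holds : ∀ ρ i → i ≤ h → Sat N S ρ (distinctSiblings i)
    distinctSiblings-holds ρ i i≤h z w = imp-intro (Sat? N S ρ′ (siblings i (suc zero) zero)) λ { (c , lw , ¬lw) e →
      All.lookup (fresh-at w (≤-antisym (≮⇒≥ (λ l → ¬lw (level⇐ w (s≤s i≤h) l))) (level⇒ w (m≤n⇒m≤1+n i≤h) lw)))
        (child-recorded i _ _ (child⇒ ρ′ (suc zero) zero i≤h c))
        (same⇒ i ρ′ (suc zero) zero (m≤n⇒m≤1+n i≤h) e) }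
      where ρ′ = extend N (extend N ρ z) w

    distinctUpTo-holds : ∀ ρ i → i ≤ h → Sat N S ρ (distinctUpTo i)
    distinctUpTo-holds ρ zero    i≤h = distinctSiblings-holds ρ zero i≤h
    distinctUpTo-holds ρ (suc i) i≤h = distinctSiblings-holds ρ (suc i) i≤h , distinctUpTo-holds ρ i (<⇒≤ i≤h)

    Φ-holds : ⊨Σ N (Φ h)
    Φ-holds = S , (λ x → level⇐ x z≤n z≤n , λ l → <⇒≱ (level⇒ x ≤-refl l) (f≤h (toℕ x))) , distinctUpTo-holds (noVars N) h ≤-refl

Φ-large-model : ∀ h → ∃ λ N → Tower h ≤ suc N × ⊨Σ N (Φ h)
Φ-large-model h = N , subst (Tower h ≤_) (sym 1+N≡) Tower≤ , Φ-holds (λ p p≤N →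
    legal-at empty w (legal (words-effect h (universe h) empty (universe-wellFormed h) (λ _ _ → refl)))
             p (subst (p <_) 1+N≡ (s≤s p≤N)))
  where
  w = words h (universe h)
  -- The order 𝒜_N has `suc N` elements, one per letter.
  N = pred (length w)
  Tower≤ : Tower h ≤ length w
  Tower≤ = subst (_≤ length w) (length-universe h) (length-words h (universe h))
  0<Tower : ∀ h → 0 < Tower h
  0<Tower zero    = s≤s z≤n
  0<Tower (suc h) = m^n>0 2 (Tower h)
  1+N≡ : suc N ≡ length w
  1+N≡ = suc-pred (length w) ⦃ >-nonZero (≤-trans (0<Tower h) Tower≤) ⦄
  open Model h N (letter w) (letter-≤ (words-levels h (universe h)))

-- Expressibility and succinctness

above : ∀ {n} → ℕ → Fin n → Fm 0 n
above zero    x = eq x x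
above (suc k) x = ex (and (lt (suc x) zero) (above k zero))

module _ {N : ℕ} {S : Fin 0 → Elem N → Bool} where

  above⇒ : ∀ k {n} (ρ : Fin n → Elem N) x → Sat N S ρ (above k x) → toℕ (ρ x) + k ≤ N
  above⇒ zero    ρ x _           = subst (_≤ N) (sym (+-identityʳ _)) (s≤s⁻¹ (toℕ<n (ρ x)))
  above⇒ (suc k) ρ x (y , l , s) = ≤-trans (≤-reflexive (+-suc _ k)) (≤-trans (+-monoˡ-≤ k l) (above⇒ k (extend N ρ y) zero s))

  above⇐ : ∀ k {n} (ρ : Fin n → Elem N) x → toℕ (ρ x) + k ≤ N → Sat N S ρ (above k x)
  above⇐ zero    ρ x _ = refl
  above⇐ (suc k) ρ x p = fromℕ< y< , ≤-reflexive (sym (toℕ-fromℕ< y<)) ,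
    above⇐ k _ zero (subst (λ y → y + k ≤ N) (sym (toℕ-fromℕ< y<)) p′)
    where
    p′ : suc (toℕ (ρ x)) + k ≤ N
    p′ = ≤-trans (≤-reflexive (sym (+-suc _ k))) p
    y< : suc (toℕ (ρ x)) < suc N
    y< = s≤s (≤-trans (m≤m+n _ k) p′)

-- The first element is not counted, so this expresses `k ≤ N`, that is, at least `suc k` elements.
atLeast : ℕ → FOSentence
atLeast k = ex (above k zero)

atLeast⇒ : ∀ {N} k → ⊨FO N (atLeast k) → k ≤ N
atLeast⇒ k (x , s) = ≤-trans (m≤n+m k _) (above⇒ k _ zero s)

atLeast⇐ : ∀ {N} k → k ≤ N → ⊨FO N (atLeast k)
atLeast⇐ k p = zero , above⇐ k _ zero p

exactly : ℕ → FOSentence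
exactly k = and (atLeast k) (neg (atLeast (suc k)))

exactly⇒ : ∀ {N} k → ⊨FO N (exactly k) → N ≡ k
exactly⇒ k (p , q) = ≤-antisym (≮⇒≥ (λ k<N → q (atLeast⇐ (suc k) k<N))) (atLeast⇒ k p)

exactly⇐ : ∀ k → ⊨FO k (exactly k)
exactly⇐ k = atLeast⇐ k ≤-refl , λ s → n≮n k (atLeast⇒ (suc k) s)

-- The double negation avoids deciding P: the sentence depends on which N < b satisfy it.
bounded-expressible : ∀ (P : ℕ → Set) b →
  ¬ ¬ (Σ FOSentence λ χ → ∀ N → (N < b × P N) ⇔ ⊨FO N χ)
bounded-expressible P zero k =
  -- A false sentence, as every order is nonempty.
  k (neg (atLeast 0) , λ N → mk⇔ (λ { (() , _) }) (λ s → contradiction (atLeast⇐ 0 z≤n) s))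
bounded-expressible P (suc b) k = bounded-expressible P b λ { (χ , χ⇔) → ¬¬-excluded-middle λ
  { (yes p) → k (or (exactly b) χ , λ N → mk⇔
      (λ { (N< , pN) → [ (λ N<b → inj₂ (Equivalence.to (χ⇔ N) (N<b , pN))) , (λ { refl → inj₁ (exactly⇐ b) }) ]′
                         (m≤n⇒m<n∨m≡n (s≤s⁻¹ N<)) })
      [ (λ s → subst (λ N → N < suc b × P N) (sym (exactly⇒ b s)) (≤-refl , p))
      , (λ s → let N<b , pN = Equivalence.from (χ⇔ N) s in m<n⇒m<1+n N<b , pN) ]′)
  ; (no ¬p) → k (χ , λ N → mk⇔
      (λ { (N< , pN) → [ (λ N<b → Equivalence.to (χ⇔ N) (N<b , pN)) , (λ { refl → contradiction pN ¬p }) ]′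
                         (m≤n⇒m<n∨m≡n (s≤s⁻¹ N<)) })
      (λ s → let N<b , pN = Equivalence.from (χ⇔ N) s in m<n⇒m<1+n N<b , pN)) } }

-- All models have `N` below `blockLength (suc h)`, so only finitely many orders matter. The double
-- negation is harmless, since the theorem is itself a negation.
Φ-expressible : ∀ h → ¬ ¬ FOExpressible (Φ h)
Φ-expressible h k = bounded-expressible (λ N → ⊨Σ N (Φ h)) (blockLength (suc h)) λ { (χ , χ⇔) →
  k (χ , λ N → mk⇔
    (λ m → Equivalence.to (χ⇔ N) (≰⇒> (λ big → Φ-bounded h N (m≤n⇒m≤1+n big) m) , m))
    (λ s → proj₂ (Equivalence.from (χ⇔ N) s))) }

-- The succinctness gap

Tower-mono : ∀ {m n} → m ≤ n → Tower m ≤ Tower n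
Tower-mono {n = zero}  z≤n     = ≤-refl
Tower-mono {n = suc n} z≤n     = m^n>0 2 (Tower n)
Tower-mono             (s≤s p) = ^-monoʳ-≤ 2 (Tower-mono p)

^2-cancel-≤ : ∀ m n → m ^ 2 ≤ n ^ 2 → m ≤ n
^2-cancel-≤ m n p = ≮⇒≥ λ n<m → <⇒≱ (^-monoˡ-< 2 n<m) p

-- The constant 20 comes from sizeΣ (Φ h) ≤ (10 * suc h) ^ 2.
exponent-small : ∀ h a m → (20 * a) ^ 2 ≤ m → m ≤ 100 * (suc h * suc h) → 2 ≤ h → a < h
exponent-small h a m p q 2≤h = ≰⇒> λ h≤a → <⇒≱ (begin-strict
  suc h       <⟨ n<1+n _ ⟩
  2 + h       ≤⟨ +-monoˡ-≤ h 2≤h ⟩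
  h + h       ≤⟨ +-mono-≤ h≤a h≤a ⟩
  a + a       ∎) a+a≤
  where
  open ≤-Reasoning
  twenty : ∀ a → 20 * a ≡ 10 * (a + a)
  twenty = solve-∀
  square : ∀ n → 100 * (n * n) ≡ (10 * n) * ((10 * n) * 1)
  square = solve-∀
  a+a≤ : a + a ≤ suc h
  a+a≤ = *-cancelˡ-≤ 10 (subst (_≤ 10 * suc h) (twenty a)
    (^2-cancel-≤ (20 * a) (10 * suc h) (≤-trans p (≤-trans q (≤-reflexive (square (suc h)))))))

theorem6p5 : ¬ (Σ (ℕ → ℕ) λ g → IsLittleOSqrt g × ((Φ : MonΣ11) → FOExpressible Φ → Σ FOSentence λ ψ → (size ψ ≤ Tower (g (sizeΣ Φ))) × ((N : ℕ) → (⊨FO N ψ ⇔ ⊨Σ N Φ))))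
theorem6p5 (g , g-small , succinct) = Φ-expressible h λ expressible →
  let ψ , |ψ|≤ , ψ⇔Φ = succinct (Φ h) expressible
      N , Tower≤ , holds = Φ-large-model h
      -- Too long for a model of `Φ h`, yet long enough that `ψ` cannot tell it from `N`.
      N′ = blockLength (suc h) + 2 ^ size ψ
      -- `2 ^ Tower (g m)` is `Tower (suc (g m))`, hence at most `Tower h`.
      2^|ψ|≤ = ≤-trans (^-monoʳ-≤ 2 |ψ|≤) (Tower-mono g<h)
  in Φ-bounded h N′ (m≤n⇒m≤1+n (m≤m+n _ _))
       (Equivalence.to (ψ⇔Φ N′)
         (long-orders-agree ψ (≤-trans 2^|ψ|≤ (m≤n⇒m≤1+n Tower≤)) (≤-trans (m≤n+m _ _) (m≤n+m _ 2))
           (Equivalence.from (ψ⇔Φ N) holds)))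
  where
  -- `IsLittleOSqrt` multiplies by `suc c`, so 19 gives the factor 20. Taking `h = 2 + M` ensures
  -- both `M ≤ m` and `2 ≤ h`.
  M = proj₁ (g-small 19)
  h = 2 + M
  m = sizeΣ (Φ h)
  g<h : g m < h
  g<h = exponent-small h (g m) m (proj₂ (g-small 19) m (≤-trans (m≤n+m M 4) (m≤m+n (2 + h) _))) (sizeΣ-Φ h) (m≤m+n 2 M)
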